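{- Let $K$ be a $d$-dimensional simplicial complex, let $r<d$, and let $\zeta\in Z_r(K)$ be a non-bounding cycle. Then every minimal solution of Topological Hitting Set for $\zeta$ induces a connected subgraph of the Hasse graph $H_K$.
   Context: Homology is simplicial with $\mathbb{Z}_2$ coefficients; chains are identified with sets of simplices. The Hasse graph $H_K$ of $K$ has a node for every simplex of $K$ and an edge for every facet-cofacet pair (pair $\sigma\subset\tau$ with $\dim\sigma=\dim\tau-1$). For a set $S$ of $r$-simplices, the subgraph of $H_K$ induced by $S$ is the subgraph induced on the union of $S$ with the set of $(r+1)$-dimensional simplices incident on (having as a facet) a simplex of $S$. A solution of Topological Hitting Set for $\zeta$ is a set $S$ of $r$-simplices of $K$ that meets every $r$-cycle homologous to $\zeta$. It is minimal if no proper subset of it is a solution. -}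

module Defs where

open import Level using (0ℓ)
open import Data.Bool.Base using (Bool; true; false; _∧_; _xor_)
open import Data.Fin.Subset using (Subset; Nonempty; inside; outside; ∣_∣; _⊆_; _⊂_)
open import Data.Fin.Subset.Properties using (_⊂?_)
open import Data.List.Base using (List; []; _∷_; _++_; foldr; map; mapMaybe)
open import Data.Maybe.Base using (Maybe; just; nothing)
open import Data.Nat.Base using (ℕ; zero; suc; _≤_)
open import Data.Nat.Properties using (_≟_)
open import Data.Product.Base using (Σ; ∃; _×_; _,_)
open import Data.Unit.Base using (⊤)
open import Data.Vec.Base using ([]; _∷_)
open import Relation.Binary.Construct.Closure.ReflexiveTransitive using (Star)
open import Relation.Binary.Construct.Closure.Symmetric using (SymClosure)
open import Relation.Binary.Core using (Rel)
open import Relation.Binary.PropositionalEquality.Core using (_≡_)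
open import Relation.Nullary.Decidable.Core using (Dec; yes; no; does; _×-dec_)
open import Relation.Nullary.Negation.Core using (¬_)
open import Relation.Unary using (Pred; Decidable; U; _∩_)

private
  variable
    n k l r : ℕ

-- The vertices are those v : Fin n with ⁅ v ⁆ a face; not every element of
-- Fin n need be one.  The empty set is not a face, so homology below is
-- unreduced.
record SimplicialComplex (n : ℕ) : Set₁ where
  field
    Face     : Pred (Subset n) 0ℓ
    face?    : Decidable Face
    nonempty : ∀ {σ} → Face σ → Nonempty σ
    closed   : ∀ {σ τ} → Face σ → τ ⊆ σ → Nonempty τ → Face τ

open SimplicialComplex

-- The proofs are irrelevant so that simplices with the same vertex set are
-- equal.
record Simplex (K : SimplicialComplex n) (k : ℕ) : Set where
  constructor simplex
  field
    vertices : Subset n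
    .face    : Face K vertices
    .size    : ∣ vertices ∣ ≡ suc k

open Simplex public using (vertices)

HasDimension : SimplicialComplex n → ℕ → Set
HasDimension K d = Simplex K d × (∀ k → Simplex K k → k ≤ d)

-- σ ⋖ τ : σ is a facet of τ.
infix 4 _⋖_ _⋖?_

_⋖_ : {K : SimplicialComplex n} → Simplex K k → Simplex K l → Set
_⋖_ {k = k} {l = l} σ τ = suc k ≡ l × vertices σ ⊂ vertices τ

_⋖?_ : {K : SimplicialComplex n} (σ : Simplex K k) (τ : Simplex K l) → Dec (σ ⋖ τ)
_⋖?_ {k = k} {l = l} σ τ = (suc k ≟ l) ×-dec (vertices σ ⊂? vertices τ)

allSubsets : ∀ n → List (Subset n)
allSubsets zero    = [] ∷ []
allSubsets (suc n) = map (outside ∷_) (allSubsets n) ++ map (inside ∷_) (allSubsets n)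

-- Every k-simplex of K, listed exactly once.
simplices : (K : SimplicialComplex n) (k : ℕ) → List (Simplex K k)
simplices {n} K k = mapMaybe toSimplex (allSubsets n)
  where
  toSimplex : Subset n → Maybe (Simplex K k)
  toSimplex σ with face? K σ ×-dec (∣ σ ∣ ≟ suc k)
  ... | yes (f , s) = just (simplex σ f s)
  ... | no  _       = nothing

SimplexSet : SimplicialComplex n → ℕ → Set
SimplexSet K k = Simplex K k → Bool

module _ {K : SimplicialComplex n} where

  infix 4 _∈ˢ_ _⊆ˢ_ _⊂ˢ_ _≈_ _∼_
  infixl 6 _⊕_

  _∈ˢ_ : Simplex K k → SimplexSet K k → Set
  σ ∈ˢ S = S σ ≡ true

  _⊆ˢ_ : Rel (SimplexSet K k) 0ℓ
  S ⊆ˢ T = ∀ σ → σ ∈ˢ S → σ ∈ˢ T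

  _⊂ˢ_ : Rel (SimplexSet K k) 0ℓ
  S ⊂ˢ T = S ⊆ˢ T × ∃ λ σ → σ ∈ˢ T × ¬ σ ∈ˢ S

  _≈_ : Rel (SimplexSet K k) 0ℓ
  S ≈ T = ∀ σ → S σ ≡ T σ

  ∅ : SimplexSet K k
  ∅ _ = false

  _⊕_ : SimplexSet K k → SimplexSet K k → SimplexSet K k
  (a ⊕ b) σ = a σ xor b σ

  facets : Simplex K (suc k) → SimplexSet K k
  facets τ σ = does (σ ⋖? τ)

  -- ∂ c is the ℤ₂-sum of facets τ over all τ in c.
  ∂ : SimplexSet K (suc k) → SimplexSet K k
  ∂ {k} c = foldr (λ τ b → (λ σ → c τ ∧ facets τ σ) ⊕ b) ∅ (simplices K (suc k))

  IsCycle : SimplexSet K k → Set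
  IsCycle {zero}  z = ⊤
  IsCycle {suc k} z = ∂ z ≈ ∅

  IsBoundary : SimplexSet K k → Set
  IsBoundary {k} z = Σ (SimplexSet K (suc k)) λ c → z ≈ ∂ c

  _∼_ : Rel (SimplexSet K k) 0ℓ
  z ∼ w = IsBoundary (z ⊕ w)

  IsSolution : SimplexSet K r → SimplexSet K r → Set
  IsSolution ζ S = ∀ z → IsCycle z → z ∼ ζ → ∃ λ σ → σ ∈ˢ S × σ ∈ˢ z

  IsMinimalSolution : SimplexSet K r → SimplexSet K r → Set
  IsMinimalSolution ζ S = IsSolution ζ S × (∀ T → T ⊂ˢ S → ¬ IsSolution ζ T)

-- The nodes are the elements of A satisfying IsNode.
record Graph (A : Set) : Set₁ where
  field
    IsNode : Pred A 0ℓ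
    Edge   : Rel A 0ℓ

open Graph

induced : {A : Set} → Graph A → Pred A 0ℓ → Graph A
induced G P = record
  { IsNode = IsNode G ∩ P
  ; Edge   = λ u v → P u × P v × Edge G u v
  }

Connected : {A : Set} → Graph A → Set
Connected G = ∃ (IsNode G) × (∀ u v → IsNode G u → IsNode G v → Star (Edge G) u v)

SomeSimplex : SimplicialComplex n → Set
SomeSimplex K = Σ ℕ (Simplex K)

HasseGraph : (K : SimplicialComplex n) → Graph (SomeSimplex K)
HasseGraph K = record
  { IsNode = U
  ; Edge   = SymClosure λ (_ , σ) (_ , τ) → σ ⋖ τ
  }

data WithCofacets {K : SimplicialComplex n} {r} (S : SimplexSet K r) : SomeSimplex K → Set where
  member  : ∀ {σ} → σ ∈ˢ S → WithCofacets S (r , σ)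
  cofacet : ∀ {σ} {τ : Simplex K (suc r)} → σ ∈ˢ S → σ ⋖ τ → WithCofacets S (suc r , τ)

inducedHasse : {K : SimplicialComplex n} → SimplexSet K r → Graph (SomeSimplex K)
inducedHasse {K = K} S = induced (HasseGraph K) (WithCofacets S)

{-# OPTIONS --safe #-}

module Submission where

-- Why the theorem holds.  Let S be a minimal solution.  It is nonempty, since
-- it has to meet ζ itself.  Call two members of S adjacent when they are facets
-- of a common (r+1)-simplex; adjacency is the shadow on S of walks in the
-- induced Hasse graph, so it is enough to join any two members u, v of S by a
-- chain of adjacent ones.  If this fails, split S into the component A of u
-- and the rest B.  Both are proper subsets of S, so neither is a solution:
-- there are cycles z₁, z₂ homologous to ζ such that z₁ misses A and z₂ misses
-- B.  Write z₁ + z₂ = ∂ c, and let c_A consist of the simplices of c having a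
-- facet in A.  Then z₂ + ∂ c_A is again a cycle homologous to ζ, and it misses
-- S:
--   * on A, the chains ∂ c_A and ∂ c agree, so z₂ + ∂ c_A = z₂ + ∂ c = z₁ = 0;
--   * on B, the chain ∂ c_A vanishes, because no simplex has facets in both A
--     and B, so z₂ + ∂ c_A = z₂ = 0.
-- This contradicts that S is a solution; see "exchange".
--
-- Two facts are needed along the way.  That z₂ + ∂ c_A is a cycle rests on
-- ∂ ∂ = 0, which reduces to the evenness of the number of subsets strictly
-- between two given subsets ("even-strictly-between").  That the component A
-- is a set with decidable membership rests on the decidability of
-- reachability in a finite graph ("star?").

open import Defs
open import Data.Bool.Base using (Bool; true; false; _∧_; _xor_)
open import Data.Bool.Properties
  using (xor-comm; xor-same; xor-assoc; xor-identityʳ; ∧-assoc; ∧-comm;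
         ∧-zeroʳ; ∧-identityʳ; ∧-distribʳ-xor)
import Data.Bool.Properties as Bool
open import Data.Fin.Subset using (Subset; inside; outside; ∣_∣; _⊂_)
open import Data.Fin.Subset.Properties using (_⊆?_; _⊂?_; p⊂q⇒∣p∣<∣q∣; p⊂q⇒p⊆q)
open import Data.List.Base using (List; []; _∷_; _++_; foldr; map; mapMaybe)
open import Data.List.Membership.Propositional using (_∈_; lose)
open import Data.List.Membership.Propositional.Properties using (∈-++⁺ˡ; ∈-++⁺ʳ; ∈-map⁺)
open import Data.List.Relation.Unary.Any using (here; there; any?; satisfied)
open import Data.Maybe.Base using (Maybe; just; nothing; maybe′)
open import Data.Nat.Base using (ℕ; zero; suc; _<_; s≤s⁻¹)
open import Data.Nat.Properties using (_≟_; ≤-antisym)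
open import Data.Product.Base using (∃; _×_; _,_; proj₁; proj₂)
open import Data.Sum.Base using (_⊎_; inj₁; inj₂)
open import Data.Unit.Base using (tt)
open import Data.Vec.Base using ([]; _∷_)
open import Data.Vec.Properties using (≡-dec)
open import Function.Base using (_∘_; const; case_of_)
open import Function.Bundles using (mk⇔)
open import Level using (0ℓ)
open import Relation.Binary.Construct.Closure.ReflexiveTransitive using (Star; ε; _◅_; _◅◅_; return)
open import Relation.Binary.Construct.Closure.Symmetric using (fwd; bwd)
open import Relation.Binary.Core using (Rel)
open import Relation.Binary.Definitions using (DecidableEquality)
import Relation.Binary.Definitions as Binary
open import Relation.Binary.PropositionalEquality
  using (_≡_; refl; sym; trans; cong; cong₂; module ≡-Reasoning)
open import Relation.Nullary.Decidable
  using (Dec; yes; no; does; dec-true; dec-false; does-⇔; _×-dec_; _⊎-dec_; ¬?; map′)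
open import Relation.Nullary.Negation using (¬_; contradiction; contradiction-irr)
open import Relation.Unary using (Decidable)

private
  variable
    n k : ℕ
    A B : Set

does-true⇒ : (a? : Dec A) → does a? ≡ true → A
does-true⇒ (yes a) refl = a

∧-does-cong : (a? : Dec A) {b c : Bool} → (A → b ≡ c) → b ∧ does a? ≡ c ∧ does a?
∧-does-cong (yes a) b≡c = cong (_∧ true) (b≡c a)
∧-does-cong (no _) {b} {c} _ = trans (∧-zeroʳ b) (sym (∧-zeroʳ c))

-- Sums in ℤ₂ over lists

-- The ℤ₂-sum of f over the entries of a list, counted with multiplicity.
parity : (A → Bool) → List A → Bool
parity f = foldr (λ x b → f x xor b) false

parity-cong : {f g : A → Bool} → (∀ x → f x ≡ g x) → ∀ xs → parity f xs ≡ parity g xs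
parity-cong f≗g []       = refl
parity-cong f≗g (x ∷ xs) = cong₂ _xor_ (f≗g x) (parity-cong f≗g xs)

parity-false : (xs : List A) → parity (const false) xs ≡ false
parity-false []       = refl
parity-false (_ ∷ xs) = parity-false xs

parity-zero : {f : A → Bool} → (∀ x → f x ≡ false) → ∀ xs → parity f xs ≡ false
parity-zero f≗0 xs = trans (parity-cong f≗0 xs) (parity-false xs)

parity-++ : (f : A → Bool) → ∀ xs ys → parity f (xs ++ ys) ≡ parity f xs xor parity f ys
parity-++ f []       ys = refl
parity-++ f (x ∷ xs) ys =
  trans (cong (f x xor_) (parity-++ f xs ys)) (sym (xor-assoc (f x) _ _))

parity-map : (f : B → Bool) (h : A → B) → ∀ xs → parity f (map h xs) ≡ parity (f ∘ h) xs
parity-map f h []       = refl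
parity-map f h (x ∷ xs) = cong (f (h x) xor_) (parity-map f h xs)

parity-mapMaybe : (f : B → Bool) (h : A → Maybe B) → ∀ xs →
                  parity f (mapMaybe h xs) ≡ parity (maybe′ f false ∘ h) xs
parity-mapMaybe f h []       = refl
parity-mapMaybe f h (x ∷ xs) with h x
... | just y  = cong (f y xor_) (parity-mapMaybe f h xs)
... | nothing = parity-mapMaybe f h xs

xor-interchange : ∀ a b c d → (a xor b) xor (c xor d) ≡ (a xor c) xor (b xor d)
xor-interchange a b c d = begin
  (a xor b) xor (c xor d)  ≡⟨ xor-assoc a b _ ⟩
  a xor (b xor (c xor d))  ≡⟨ cong (a xor_) (xor-assoc b c d) ⟨
  a xor ((b xor c) xor d)  ≡⟨ cong (λ e → a xor (e xor d)) (xor-comm b c) ⟩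
  a xor ((c xor b) xor d)  ≡⟨ cong (a xor_) (xor-assoc c b d) ⟩
  a xor (c xor (b xor d))  ≡⟨ xor-assoc a c _ ⟨
  (a xor c) xor (b xor d)  ∎
  where open ≡-Reasoning

parity-xor : (f g : A → Bool) → ∀ xs →
             parity (λ x → f x xor g x) xs ≡ parity f xs xor parity g xs
parity-xor f g []       = refl
parity-xor f g (x ∷ xs) =
  trans (cong ((f x xor g x) xor_) (parity-xor f g xs)) (xor-interchange (f x) (g x) _ _)

parity-∧ˡ : (a : Bool) (f : A → Bool) → ∀ xs → parity (λ x → a ∧ f x) xs ≡ a ∧ parity f xs
parity-∧ˡ false f xs = parity-false xs
parity-∧ˡ true  f xs = refl

parity-∧ʳ : (f : A → Bool) (a : Bool) → ∀ xs → parity (λ x → f x ∧ a) xs ≡ parity f xs ∧ a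
parity-∧ʳ f a xs =
  trans (parity-cong (λ x → ∧-comm (f x) a) xs) (trans (parity-∧ˡ a f xs) (∧-comm a _))

parity-swap : (f : A → B → Bool) → ∀ xs ys →
              parity (λ x → parity (f x) ys) xs ≡ parity (λ y → parity (λ x → f x y) xs) ys
parity-swap f []       ys = sym (parity-false ys)
parity-swap f (x ∷ xs) ys =
  trans (cong (parity (f x) ys xor_) (parity-swap f xs ys)) (sym (parity-xor (f x) _ ys))

-- Counting subsets between two given subsets

parity-allSubsets : (f : Subset (suc n) → Bool) →
  parity f (allSubsets (suc n)) ≡
  parity (f ∘ (outside ∷_)) (allSubsets n) xor parity (f ∘ (inside ∷_)) (allSubsets n)
parity-allSubsets {n} f = trans
  (parity-++ f (map (outside ∷_) (allSubsets n)) _)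
  (cong₂ _xor_ (parity-map f (outside ∷_) (allSubsets n)) (parity-map f (inside ∷_) (allSubsets n)))

-- Indicators of σ lying between ρ and τ: the first symbol relates ρ to σ, the
-- second σ to τ.
module _ (ρ σ τ : Subset n) where

  [⊆⊆] [⊂⊆] [⊆⊂] [⊂⊂] : Bool
  [⊆⊆] = does (ρ ⊆? σ) ∧ does (σ ⊆? τ)
  [⊂⊆] = does (ρ ⊂? σ) ∧ does (σ ⊆? τ)
  [⊆⊂] = does (ρ ⊆? σ) ∧ does (σ ⊂? τ)
  [⊂⊂] = does (ρ ⊂? σ) ∧ does (σ ⊂? τ)

-- The intervals (ρ, τ] and [ρ, τ) have the same number of elements modulo 2:
-- both arise from [ρ, τ] by leaving out one end, or are empty.
even-half-open : (ρ τ : Subset n) →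
  parity (λ σ → [⊂⊆] ρ σ τ xor [⊆⊂] ρ σ τ) (allSubsets n) ≡ false
even-half-open [] [] = refl
even-half-open {suc n} (s ∷ ρ) (t ∷ τ) =
  trans (parity-allSubsets λ σ → [⊂⊆] (s ∷ ρ) σ (t ∷ τ) xor [⊆⊂] (s ∷ ρ) σ (t ∷ τ)) (step s t)
  where
  open ≡-Reasoning

  part : (s t x : Bool) → Bool
  part s t x = parity (λ σ → [⊂⊆] (s ∷ ρ) (x ∷ σ) (t ∷ τ) xor [⊆⊂] (s ∷ ρ) (x ∷ σ) (t ∷ τ))
                      (allSubsets n)

  none : (f g : Subset n → Bool) →
         parity (λ σ → (f σ ∧ false) xor (g σ ∧ false)) (allSubsets n) ≡ false
  none f g = parity-zero (λ σ → cong₂ _xor_ (∧-zeroʳ (f σ)) (∧-zeroʳ (g σ))) (allSubsets n)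

  cancel : ∀ a b c → (a xor b) xor (b xor c) ≡ a xor c
  cancel a b c = trans (xor-assoc a b _) (cong (a xor_)
    (trans (sym (xor-assoc b b c)) (cong (_xor c) (xor-same b))))

  step : ∀ s t → part s t outside xor part s t inside ≡ false
  step outside outside = cong₂ _xor_ (even-half-open ρ τ)
    (none (λ σ → does (ρ ⊆? σ)) (λ σ → does (ρ ⊆? σ)))
  step inside outside = cong₂ _xor_ (parity-false (allSubsets n))
    (none (λ σ → does (ρ ⊂? σ)) (λ σ → does (ρ ⊆? σ)))
  step inside inside = cong₂ _xor_ (parity-false (allSubsets n)) (even-half-open ρ τ)
  -- The summands [⊆⊆] coming from both choices for the first element cancel.
  step outside inside = begin
    part outside inside outside xor part outside inside inside
      ≡⟨ parity-xor (λ σ → [⊂⊆] ρ σ τ xor [⊆⊆] ρ σ τ) (λ σ → [⊆⊆] ρ σ τ xor [⊆⊂] ρ σ τ)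
           (allSubsets n) ⟨
    parity (λ σ → ([⊂⊆] ρ σ τ xor [⊆⊆] ρ σ τ) xor ([⊆⊆] ρ σ τ xor [⊆⊂] ρ σ τ)) (allSubsets n)
      ≡⟨ parity-cong (λ σ → cancel ([⊂⊆] ρ σ τ) ([⊆⊆] ρ σ τ) ([⊆⊂] ρ σ τ)) (allSubsets n) ⟩
    parity (λ σ → [⊂⊆] ρ σ τ xor [⊆⊂] ρ σ τ) (allSubsets n)
      ≡⟨ even-half-open ρ τ ⟩
    false ∎

-- Between ρ ⊂ τ differing in m elements there are 2 ^ m - 2 subsets, and m > 0;
-- in all other cases there are none.
even-strictly-between : (ρ τ : Subset n) →
  parity (λ σ → [⊂⊂] ρ σ τ) (allSubsets n) ≡ false
even-strictly-between [] [] = refl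
even-strictly-between {suc n} (s ∷ ρ) (t ∷ τ) =
  trans (parity-allSubsets λ σ → [⊂⊂] (s ∷ ρ) σ (t ∷ τ)) (step s t)
  where
  part : (s t x : Bool) → Bool
  part s t x = parity (λ σ → [⊂⊂] (s ∷ ρ) (x ∷ σ) (t ∷ τ)) (allSubsets n)

  none : (f : Subset n → Bool) → parity (λ σ → f σ ∧ false) (allSubsets n) ≡ false
  none f = parity-zero (λ σ → ∧-zeroʳ (f σ)) (allSubsets n)

  step : ∀ s t → part s t outside xor part s t inside ≡ false
  step outside outside = cong₂ _xor_ (even-strictly-between ρ τ) (none λ σ → does (ρ ⊆? σ))
  step outside inside  = trans
    (sym (parity-xor (λ σ → [⊂⊆] ρ σ τ) (λ σ → [⊆⊂] ρ σ τ) (allSubsets n)))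
    (even-half-open ρ τ)
  step inside  outside = cong₂ _xor_ (parity-false (allSubsets n)) (none λ σ → does (ρ ⊂? σ))
  step inside  inside  = cong₂ _xor_ (parity-false (allSubsets n)) (even-strictly-between ρ τ)

-- The enumeration of simplices

∈-allSubsets : (σ : Subset n) → σ ∈ allSubsets n
∈-allSubsets []            = here refl
∈-allSubsets (outside ∷ σ) = ∈-++⁺ˡ (∈-map⁺ (outside ∷_) (∈-allSubsets σ))
∈-allSubsets (inside ∷ σ)  = ∈-++⁺ʳ _ (∈-map⁺ (inside ∷_) (∈-allSubsets σ))

∈-mapMaybe : (h : A → Maybe B) {x : A} {y : B} {xs : List A} →
             h x ≡ just y → x ∈ xs → y ∈ mapMaybe h xs
∈-mapMaybe h {xs = x ∷ xs} hx≡y (here refl) with h x | hx≡y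
... | just _ | refl = here refl
∈-mapMaybe h {xs = x ∷ xs} hx≡y (there x∈xs) with h x
... | just _  = there (∈-mapMaybe h hx≡y x∈xs)
... | nothing = ∈-mapMaybe h hx≡y x∈xs

module _ (K : SimplicialComplex n) (k : ℕ) where

  -- Unification recovers the partial function enumerating the simplices, which
  -- is local to the definition of "simplices".
  simplices-mapMaybe : ∃ λ (h : Subset n → Maybe (Simplex K k)) →
                       simplices K k ≡ mapMaybe h (allSubsets n)
  simplices-mapMaybe = _ , refl

  -- The simplex with a given set of vertices, if there is one of dimension k.
  toSimplex : Subset n → Maybe (Simplex K k)
  toSimplex = proj₁ simplices-mapMaybe

module _ {K : SimplicialComplex n} where

  open SimplicialComplex K

  toSimplex-vertices : (σ : Simplex K k) → toSimplex K k (vertices σ) ≡ just σ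
  toSimplex-vertices {k} (simplex σ f s) with face? σ ×-dec (∣ σ ∣ ≟ suc k)
  ... | yes _ = refl
  ... | no ¬p = contradiction-irr (f , s) ¬p

  ∈-simplices : (σ : Simplex K k) → σ ∈ simplices K k
  ∈-simplices {k} σ =
    ∈-mapMaybe (toSimplex K k) (toSimplex-vertices σ) (∈-allSubsets (vertices σ))

  anySimplex? : {P : Simplex K k → Set} → Decidable P → Dec (∃ P)
  anySimplex? {k} P? =
    map′ satisfied (λ (σ , p) → lose (∈-simplices σ) p) (any? P? (simplices K k))

  infix 4 _≟ˢ_
  _≟ˢ_ : DecidableEquality (Simplex K k)
  simplex σ _ _ ≟ˢ simplex τ _ _ =
    map′ (λ { refl → refl }) (cong vertices) (≡-dec Bool._≟_ σ τ)

  -- A set strictly between two simplices whose dimensions differ by two is a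
  -- simplex of the dimension in between.
  between-simplices : (ρ : Simplex K k) (τ : Simplex K (suc (suc k))) {σ : Subset n} →
                      vertices ρ ⊂ σ → σ ⊂ vertices τ → ∃ λ σ′ → toSimplex K (suc k) σ ≡ just σ′
  between-simplices {k} (simplex ρ fρ sρ) (simplex τ fτ sτ) {σ} ρ⊂σ σ⊂τ
    with face? σ ×-dec (∣ σ ∣ ≟ suc (suc k))
  ... | yes _ = _ , refl
  ... | no ¬p = contradiction-irr (face-σ fρ fτ , size-σ sρ sτ) ¬p
    where
    face-σ : Face ρ → Face τ → Face σ
    face-σ fρ fτ = closed fτ (p⊂q⇒p⊆q σ⊂τ) (let x , x∈ρ = nonempty fρ in x , p⊂q⇒p⊆q ρ⊂σ x∈ρ)
    size-σ : ∣ ρ ∣ ≡ suc k → ∣ τ ∣ ≡ suc (suc (suc k)) → ∣ σ ∣ ≡ suc (suc k)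
    size-σ sρ sτ with lo ← p⊂q⇒∣p∣<∣q∣ ρ⊂σ | hi ← p⊂q⇒∣p∣<∣q∣ σ⊂τ rewrite sρ | sτ =
      ≤-antisym (s≤s⁻¹ hi) lo

  toSimplex-just : (σ : Subset n) {σ′ : Simplex K k} → toSimplex K k σ ≡ just σ′ → vertices σ′ ≡ σ
  toSimplex-just {k} σ eq with face? σ ×-dec (∣ σ ∣ ≟ suc k) | eq
  ... | yes _ | refl = refl

-- The boundary operator

  facets-⊂ : (τ : Simplex K (suc k)) (σ : Simplex K k) →
             facets τ σ ≡ does (vertices σ ⊂? vertices τ)
  facets-⊂ τ σ = does-⇔ (mk⇔ proj₂ (refl ,_)) (σ ⋖? τ) (vertices σ ⊂? vertices τ)

  ∂-parity : (c : SimplexSet K (suc k)) (σ : Simplex K k) →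
             ∂ c σ ≡ parity (λ τ → c τ ∧ facets τ σ) (simplices K (suc k))
  ∂-parity {k} c σ = go (simplices K (suc k))
    where
    go : ∀ τs → foldr (λ τ b → (λ σ → c τ ∧ facets τ σ) ⊕ b) ∅ τs σ ≡
                parity (λ τ → c τ ∧ facets τ σ) τs
    go []       = refl
    go (τ ∷ τs) = cong ((c τ ∧ facets τ σ) xor_) (go τs)

  ∂-cong-at : (c d : SimplexSet K (suc k)) (σ : Simplex K k) →
              (∀ τ → σ ⋖ τ → c τ ≡ d τ) → ∂ c σ ≡ ∂ d σ
  ∂-cong-at {k} c d σ eq = trans (∂-parity c σ) (trans
    (parity-cong (λ τ → ∧-does-cong (σ ⋖? τ) (eq τ)) (simplices K (suc k)))
    (sym (∂-parity d σ)))

  ∂-∅ : ∂ ∅ ≈ ∅ {K = K} {k = k}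
  ∂-∅ {k} σ = trans (∂-parity ∅ σ) (parity-false (simplices K (suc k)))

  ∂-⊕ : (c d : SimplexSet K (suc k)) → ∂ (c ⊕ d) ≈ ∂ c ⊕ ∂ d
  ∂-⊕ {k} c d σ = begin
    ∂ (c ⊕ d) σ
      ≡⟨ ∂-parity (c ⊕ d) σ ⟩
    parity (λ τ → (c τ xor d τ) ∧ facets τ σ) τs
      ≡⟨ parity-cong (λ τ → ∧-distribʳ-xor (facets τ σ) (c τ) (d τ)) τs ⟩
    parity (λ τ → (c τ ∧ facets τ σ) xor (d τ ∧ facets τ σ)) τs
      ≡⟨ parity-xor (λ τ → c τ ∧ facets τ σ) (λ τ → d τ ∧ facets τ σ) τs ⟩
    parity (λ τ → c τ ∧ facets τ σ) τs xor parity (λ τ → d τ ∧ facets τ σ) τs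
      ≡⟨ cong₂ _xor_ (∂-parity c σ) (∂-parity d σ) ⟨
    ∂ c σ xor ∂ d σ ∎
    where
    open ≡-Reasoning
    τs = simplices K (suc k)

  -- The number of simplices strictly between ρ and τ is even.
  even-facets : (τ : Simplex K (suc (suc k))) (ρ : Simplex K k) →
                parity (λ σ → facets τ σ ∧ facets σ ρ) (simplices K (suc k)) ≡ false
  even-facets {k} τ ρ = begin
    parity (λ σ → facets τ σ ∧ facets σ ρ) (simplices K (suc k))
      ≡⟨ parity-mapMaybe (λ σ → facets τ σ ∧ facets σ ρ) (toSimplex K (suc k)) (allSubsets n) ⟩
    parity (maybe′ (λ σ → facets τ σ ∧ facets σ ρ) false ∘ toSimplex K (suc k)) (allSubsets n)
      ≡⟨ parity-cong pointwise (allSubsets n) ⟩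
    parity (λ σ → [⊂⊂] (vertices ρ) σ (vertices τ)) (allSubsets n)
      ≡⟨ even-strictly-between (vertices ρ) (vertices τ) ⟩
    false ∎
    where
    open ≡-Reasoning
    not-between : (σ : Subset n) → toSimplex K (suc k) σ ≡ nothing →
                  ¬ (vertices ρ ⊂ σ × σ ⊂ vertices τ)
    not-between σ eq (ρ⊂σ , σ⊂τ)
      with _ , eq′ ← between-simplices ρ τ ρ⊂σ σ⊂τ = case trans (sym eq) eq′ of λ ()

    pointwise : ∀ σ → maybe′ (λ σ → facets τ σ ∧ facets σ ρ) false (toSimplex K (suc k) σ) ≡
                      [⊂⊂] (vertices ρ) σ (vertices τ)
    pointwise σ with toSimplex K (suc k) σ in eq
    ... | nothing = sym (dec-false ((vertices ρ ⊂? σ) ×-dec (σ ⊂? vertices τ)) (not-between σ eq))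
    ... | just σ′ with refl ← toSimplex-just σ eq =
      trans (cong₂ _∧_ (facets-⊂ τ σ′) (facets-⊂ σ′ ρ)) (∧-comm (does (σ ⊂? vertices τ)) (does (vertices ρ ⊂? σ)))

  ∂∂≈∅ : (c : SimplexSet K (suc (suc k))) → ∂ (∂ c) ≈ ∅
  ∂∂≈∅ {k} c ρ = begin
    ∂ (∂ c) ρ
      ≡⟨ ∂-parity (∂ c) ρ ⟩
    parity (λ σ → ∂ c σ ∧ facets σ ρ) σs
      ≡⟨ parity-cong (λ σ → cong (_∧ facets σ ρ) (∂-parity c σ)) σs ⟩
    parity (λ σ → parity (λ τ → c τ ∧ facets τ σ) τs ∧ facets σ ρ) σs
      ≡⟨ parity-cong (λ σ → sym (parity-∧ʳ (λ τ → c τ ∧ facets τ σ) (facets σ ρ) τs)) σs ⟩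
    parity (λ σ → parity (λ τ → (c τ ∧ facets τ σ) ∧ facets σ ρ) τs) σs
      ≡⟨ parity-swap (λ σ τ → (c τ ∧ facets τ σ) ∧ facets σ ρ) σs τs ⟩
    parity (λ τ → parity (λ σ → (c τ ∧ facets τ σ) ∧ facets σ ρ) σs) τs
      ≡⟨ parity-cong vanish τs ⟩
    parity (const false) τs
      ≡⟨ parity-false τs ⟩
    false ∎
    where
    open ≡-Reasoning
    σs = simplices K (suc k)
    τs = simplices K (suc (suc k))
    vanish : ∀ τ → parity (λ σ → (c τ ∧ facets τ σ) ∧ facets σ ρ) σs ≡ false
    vanish τ = begin
      parity (λ σ → (c τ ∧ facets τ σ) ∧ facets σ ρ) σs
        ≡⟨ parity-cong (λ σ → ∧-assoc (c τ) (facets τ σ) (facets σ ρ)) σs ⟩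
      parity (λ σ → c τ ∧ (facets τ σ ∧ facets σ ρ)) σs
        ≡⟨ parity-∧ˡ (c τ) (λ σ → facets τ σ ∧ facets σ ρ) σs ⟩
      c τ ∧ parity (λ σ → facets τ σ ∧ facets σ ρ) σs
        ≡⟨ cong (c τ ∧_) (even-facets τ ρ) ⟩
      c τ ∧ false
        ≡⟨ ∧-zeroʳ (c τ) ⟩
      false ∎

-- Cycles and homology

  IsCycle-⊕-∂ : (z : SimplexSet K k) (c : SimplexSet K (suc k)) → IsCycle z → IsCycle (z ⊕ ∂ c)
  IsCycle-⊕-∂ {zero}  z c _     = tt
  IsCycle-⊕-∂ {suc k} z c ∂z≈∅ ρ =
    trans (∂-⊕ z (∂ c) ρ) (cong₂ _xor_ (∂z≈∅ ρ) (∂∂≈∅ c ρ))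

  ∼-refl : (z : SimplexSet K k) → z ∼ z
  ∼-refl z = ∅ , λ σ → trans (xor-same (z σ)) (sym (∂-∅ σ))

  ∼-⊕-∂ : (z w : SimplexSet K k) (c : SimplexSet K (suc k)) → z ∼ w → (z ⊕ ∂ c) ∼ w
  ∼-⊕-∂ z w c (b , z⊕w≈∂b) = b ⊕ c , λ σ → begin
    (z σ xor ∂ c σ) xor w σ  ≡⟨ xor-assoc (z σ) _ _ ⟩
    z σ xor (∂ c σ xor w σ)  ≡⟨ cong (z σ xor_) (xor-comm (∂ c σ) (w σ)) ⟩
    z σ xor (w σ xor ∂ c σ)  ≡⟨ xor-assoc (z σ) _ _ ⟨
    (z σ xor w σ) xor ∂ c σ  ≡⟨ cong (_xor ∂ c σ) (z⊕w≈∂b σ) ⟩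
    ∂ b σ xor ∂ c σ          ≡⟨ ∂-⊕ b c σ ⟨
    ∂ (b ⊕ c) σ              ∎
    where open ≡-Reasoning

  ∼-common : (z₁ z₂ w : SimplexSet K k) → z₁ ∼ w → z₂ ∼ w → z₁ ∼ z₂
  ∼-common z₁ z₂ w (c₁ , eq₁) (c₂ , eq₂) = c₁ ⊕ c₂ , λ σ → begin
    z₁ σ xor z₂ σ                      ≡⟨ xor-identityʳ _ ⟨
    (z₁ σ xor z₂ σ) xor false          ≡⟨ cong ((z₁ σ xor z₂ σ) xor_) (xor-same (w σ)) ⟨
    (z₁ σ xor z₂ σ) xor (w σ xor w σ)  ≡⟨ xor-interchange (z₁ σ) (z₂ σ) (w σ) (w σ) ⟩
    (z₁ σ xor w σ) xor (z₂ σ xor w σ)  ≡⟨ cong₂ _xor_ (eq₁ σ) (eq₂ σ) ⟩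
    ∂ c₁ σ xor ∂ c₂ σ                  ≡⟨ ∂-⊕ c₁ c₂ σ ⟨
    ∂ (c₁ ⊕ c₂) σ                      ∎
    where open ≡-Reasoning

-- The exchange argument

  -- S and z have a common simplex; a solution for ζ is a set that meets every
  -- cycle homologous to ζ.
  Meets : SimplexSet K k → SimplexSet K k → Set
  Meets S z = ∃ λ σ → σ ∈ˢ S × σ ∈ˢ z

  meets? : (S z : SimplexSet K k) → Dec (Meets S z)
  meets? S z = anySimplex? λ σ → (S σ Bool.≟ true) ×-dec (z σ Bool.≟ true)

  -- No simplex has a facet in P and a facet in Q.
  Separated : SimplexSet K k → SimplexSet K k → Set
  Separated {k} P Q = ∀ (σ σ′ : Simplex K k) (τ : Simplex K (suc k)) →
                      σ ∈ˢ P → σ′ ∈ˢ Q → σ ⋖ τ → ¬ σ′ ⋖ τ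

  hasFacetIn? : (P : SimplexSet K k) (τ : Simplex K (suc k)) → Dec (∃ λ σ → σ ∈ˢ P × σ ⋖ τ)
  hasFacetIn? P τ = anySimplex? λ σ → (P σ Bool.≟ true) ×-dec (σ ⋖? τ)

  -- The part of c formed by the simplices with a facet in P.
  restrict : SimplexSet K (suc k) → SimplexSet K k → SimplexSet K (suc k)
  restrict c P τ = c τ ∧ does (hasFacetIn? P τ)

  ∂-restrict-on : (c : SimplexSet K (suc k)) (P : SimplexSet K k) →
                  ∀ σ → σ ∈ˢ P → ∂ (restrict c P) σ ≡ ∂ c σ
  ∂-restrict-on c P σ σ∈P = ∂-cong-at (restrict c P) c σ λ τ σ⋖τ →
    trans (cong (c τ ∧_) (dec-true (hasFacetIn? P τ) (σ , σ∈P , σ⋖τ))) (∧-identityʳ (c τ))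

  ∂-restrict-off : (c : SimplexSet K (suc k)) {P Q : SimplexSet K k} → Separated P Q →
                   ∀ σ → σ ∈ˢ Q → ∂ (restrict c P) σ ≡ false
  ∂-restrict-off c {P} {Q} sep σ σ∈Q = trans
    (∂-cong-at (restrict c P) ∅ σ λ τ σ⋖τ → trans
      (cong (c τ ∧_) (dec-false (hasFacetIn? P τ) λ (σ′ , σ′∈P , σ′⋖τ) → sep σ′ σ τ σ′∈P σ∈Q σ′⋖τ σ⋖τ))
      (∧-zeroʳ (c τ)))
    (∂-∅ σ)

  -- Two cycles, each missing one of two separated sets, can be traded for one
  -- cycle in the same class that misses both.
  exchange : {P Q ζ : SimplexSet K k} → Separated P Q → (z₁ z₂ : SimplexSet K k) →
             z₁ ∼ ζ → IsCycle z₂ → z₂ ∼ ζ → ¬ Meets P z₁ → ¬ Meets Q z₂ →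
             ∃ λ z → IsCycle z × z ∼ ζ × ¬ Meets P z × ¬ Meets Q z
  exchange {P = P} {Q} {ζ} sep z₁ z₂ z₁∼ζ cycle₂ z₂∼ζ P#z₁ Q#z₂ =
    z , IsCycle-⊕-∂ z₂ cP cycle₂ , ∼-⊕-∂ z₂ ζ cP z₂∼ζ , P#z , Q#z
    where
    open ≡-Reasoning
    z₂∼z₁ = ∼-common z₂ z₁ ζ z₂∼ζ z₁∼ζ
    c  = proj₁ z₂∼z₁
    cP = restrict c P
    z  = z₂ ⊕ ∂ cP

    z≡z₁ : ∀ σ → σ ∈ˢ P → z σ ≡ z₁ σ
    z≡z₁ σ σ∈P = begin
      z₂ σ xor ∂ cP σ          ≡⟨ cong (z₂ σ xor_) (∂-restrict-on c P σ σ∈P) ⟩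
      z₂ σ xor ∂ c σ           ≡⟨ cong (z₂ σ xor_) (proj₂ z₂∼z₁ σ) ⟨
      z₂ σ xor (z₂ σ xor z₁ σ) ≡⟨ xor-assoc (z₂ σ) _ _ ⟨
      (z₂ σ xor z₂ σ) xor z₁ σ ≡⟨ cong (_xor z₁ σ) (xor-same (z₂ σ)) ⟩
      z₁ σ                     ∎

    z≡z₂ : ∀ σ → σ ∈ˢ Q → z σ ≡ z₂ σ
    z≡z₂ σ σ∈Q = trans (cong (z₂ σ xor_) (∂-restrict-off c {P} {Q} sep σ σ∈Q)) (xor-identityʳ (z₂ σ))

    P#z : ¬ Meets P z
    P#z (σ , σ∈P , σ∈z) = P#z₁ (σ , σ∈P , trans (sym (z≡z₁ σ σ∈P)) σ∈z)

    Q#z : ¬ Meets Q z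
    Q#z (σ , σ∈Q , σ∈z) = Q#z₂ (σ , σ∈Q , trans (sym (z≡z₂ σ σ∈Q)) σ∈z)

  -- If two separated sets cover a solution, then one of them is a solution.
  separated-solution : {P Q S ζ : SimplexSet K k} → Separated P Q →
                       (∀ σ → σ ∈ˢ S → σ ∈ˢ P ⊎ σ ∈ˢ Q) →
                       IsSolution ζ S → ¬ IsSolution ζ P → ¬ ¬ IsSolution ζ Q
  separated-solution {P = P} {Q} {S} {ζ} sep S⊆P∪Q solS ¬solP ¬solQ = ¬solP solP
    where
    solP : IsSolution ζ P
    solP z₁ _ z₁∼ζ with meets? P z₁
    ... | yes P∩z₁ = P∩z₁
    ... | no  P#z₁ = contradiction solQ ¬solQ
      where
      solQ : IsSolution ζ Q
      solQ z₂ cycle₂ z₂∼ζ with meets? Q z₂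
      ... | yes Q∩z₂ = Q∩z₂
      ... | no  Q#z₂
        with z , cycle , z∼ζ , P#z , Q#z ← exchange {P = P} {Q} {ζ} sep z₁ z₂ z₁∼ζ cycle₂ z₂∼ζ P#z₁ Q#z₂
        with σ , σ∈S , σ∈z ← solS z cycle z∼ζ
        with S⊆P∪Q σ σ∈S
      ... | inj₁ σ∈P = contradiction (σ , σ∈P , σ∈z) P#z
      ... | inj₂ σ∈Q = contradiction (σ , σ∈Q , σ∈z) Q#z

-- Decidability of reachability in a finite graph

module _ {A : Set} {R : Rel A 0ℓ} (_≟ᴬ_ : DecidableEquality A) (R? : Binary.Decidable R) where

  -- There is a walk from x to y of which every inner node belongs to xs.  As
  -- in Warshall's algorithm, a walk through the head v is given by its part
  -- before the first and its part after the last visit to v.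
  Via : List A → Rel A 0ℓ
  Via []       x y = x ≡ y ⊎ R x y
  Via (v ∷ xs) x y = Via xs x y ⊎ (Via xs x v × Via xs v y)

  via? : ∀ xs → Binary.Decidable (Via xs)
  via? []       x y = (x ≟ᴬ y) ⊎-dec R? x y
  via? (v ∷ xs) x y = via? xs x y ⊎-dec (via? xs x v ×-dec via? xs v y)

  via⇒star : ∀ xs {x y} → Via xs x y → Star R x y
  via⇒star []       (inj₁ refl)    = ε
  via⇒star []       (inj₂ r)       = return r
  via⇒star (v ∷ xs) (inj₁ p)       = via⇒star xs p
  via⇒star (v ∷ xs) (inj₂ (p , q)) = via⇒star xs p ◅◅ via⇒star xs q

  step⇒via : ∀ xs {x y} → x ≡ y ⊎ R x y → Via xs x y
  step⇒via []       p = p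
  step⇒via (v ∷ xs) p = inj₁ (step⇒via xs p)

  to-head : ∀ {v xs x} → Via (v ∷ xs) x v → Via xs x v
  to-head (inj₁ p)       = p
  to-head (inj₂ (p , _)) = p

  from-head : ∀ {v xs y} → Via (v ∷ xs) v y → Via xs v y
  from-head (inj₁ p)       = p
  from-head (inj₂ (_ , p)) = p

  via-trans : ∀ {xs x w y} → w ∈ xs → Via xs x w → Via xs w y → Via xs x y
  via-trans (here refl) p q = inj₂ (to-head p , from-head q)
  via-trans (there w∈) (inj₁ p)       (inj₁ q)       = inj₁ (via-trans w∈ p q)
  via-trans (there w∈) (inj₁ p)       (inj₂ (q , r)) = inj₂ (via-trans w∈ p q , r)
  via-trans (there w∈) (inj₂ (p , q)) (inj₁ r)       = inj₂ (p , via-trans w∈ q r)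
  via-trans (there w∈) (inj₂ (p , _)) (inj₂ (_ , r)) = inj₂ (p , r)

  star⇒via : ∀ {xs} → (∀ x → x ∈ xs) → ∀ {x y} → Star R x y → Via xs x y
  star⇒via {xs} all ε       = step⇒via xs (inj₁ refl)
  star⇒via {xs} all (r ◅ p) = via-trans (all _) (step⇒via xs (inj₂ r)) (star⇒via all p)

  star? : ∀ {xs} → (∀ x → x ∈ xs) → Binary.Decidable (Star R)
  star? {xs} all x y = map′ (via⇒star xs) (star⇒via all) (via? xs x y)

-- Connectedness of minimal solutions

module _ {K : SimplicialComplex n} (S : SimplexSet K k) where

  -- Members of S are adjacent when they are facets of a common simplex; a
  -- member with a cofacet is adjacent to itself.
  Adjacent : Rel (Simplex K k) 0ℓ
  Adjacent σ σ′ = σ ∈ˢ S × σ′ ∈ˢ S × ∃ λ (τ : Simplex K (suc k)) → σ ⋖ τ × σ′ ⋖ τ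

  adjacent? : Binary.Decidable Adjacent
  adjacent? σ σ′ = (S σ Bool.≟ true) ×-dec (S σ′ Bool.≟ true) ×-dec
                   anySimplex? λ τ → (σ ⋖? τ) ×-dec (σ′ ⋖? τ)

  reachable? : Binary.Decidable (Star Adjacent)
  reachable? = star? _≟ˢ_ adjacent? ∈-simplices

  minimal⇒reachable : {ζ : SimplexSet K k} → IsMinimalSolution ζ S →
                      ∀ {u v} → u ∈ˢ S → v ∈ˢ S → Star Adjacent u v
  minimal⇒reachable {ζ} (sol , minimal) {u} {v} u∈S v∈S with reachable? u v
  ... | yes u↝v  = u↝v
  ... | no  u↝̸v =
    contradiction (minimal rest rest⊂S)
      (separated-solution {P = component} {rest} {S} {ζ} separated covers sol
        (minimal component component⊂S))
    where
    inComponent? : ∀ σ → Dec (σ ∈ˢ S × Star Adjacent u σ)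
    inComponent? σ = (S σ Bool.≟ true) ×-dec reachable? u σ

    inRest? : ∀ σ → Dec (σ ∈ˢ S × ¬ Star Adjacent u σ)
    inRest? σ = (S σ Bool.≟ true) ×-dec ¬? (reachable? u σ)

    component rest : SimplexSet K k
    component σ = does (inComponent? σ)
    rest      σ = does (inRest? σ)

    component⊂S : component ⊂ˢ S
    component⊂S = (λ σ → proj₁ ∘ does-true⇒ (inComponent? σ)) ,
                  v , v∈S , u↝̸v ∘ proj₂ ∘ does-true⇒ (inComponent? v)

    rest⊂S : rest ⊂ˢ S
    rest⊂S = (λ σ → proj₁ ∘ does-true⇒ (inRest? σ)) ,
             u , u∈S , λ u∈rest → proj₂ (does-true⇒ (inRest? u) u∈rest) ε

    covers : ∀ σ → σ ∈ˢ S → σ ∈ˢ component ⊎ σ ∈ˢ rest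
    covers σ σ∈S = case reachable? u σ of λ where
      (yes u↝σ)  → inj₁ (dec-true (inComponent? σ) (σ∈S , u↝σ))
      (no  u↝̸σ) → inj₂ (dec-true (inRest? σ) (σ∈S , u↝̸σ))

    separated : Separated component rest
    separated σ σ′ τ σ∈ σ′∈ σ⋖τ σ′⋖τ
      with σ∈S , u↝σ ← does-true⇒ (inComponent? σ) σ∈
      with σ′∈S , u↝̸σ′ ← does-true⇒ (inRest? σ′) σ′∈ =
      u↝̸σ′ (u↝σ ◅◅ return (σ∈S , σ′∈S , τ , σ⋖τ , σ′⋖τ))

  -- Walks in the induced subgraph of the Hasse graph.
  Walk : Rel (SomeSimplex K) 0ℓ
  Walk = Star (Graph.Edge (inducedHasse S))

  up : ∀ {σ} {τ : Simplex K (suc k)} → σ ∈ˢ S → σ ⋖ τ → Walk (k , σ) (suc k , τ)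
  up σ∈S σ⋖τ = return (member σ∈S , cofacet σ∈S σ⋖τ , fwd σ⋖τ)

  down : ∀ {σ} {τ : Simplex K (suc k)} → σ ∈ˢ S → σ ⋖ τ → Walk (suc k , τ) (k , σ)
  down σ∈S σ⋖τ = return (cofacet σ∈S σ⋖τ , member σ∈S , bwd σ⋖τ)

  reachable⇒walk : ∀ {u v} → Star Adjacent u v → Walk (k , u) (k , v)
  reachable⇒walk ε = ε
  reachable⇒walk ((σ∈S , σ′∈S , τ , σ⋖τ , σ′⋖τ) ◅ p) =
    up {τ = τ} σ∈S σ⋖τ ◅◅ down σ′∈S σ′⋖τ ◅◅ reachable⇒walk p

  walk-to-member : ∀ {x} → WithCofacets S x → ∃ λ σ → σ ∈ˢ S × Walk x (k , σ) × Walk (k , σ) x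
  walk-to-member (member σ∈S)      = _ , σ∈S , ε , ε
  walk-to-member (cofacet σ∈S σ⋖τ) = _ , σ∈S , down σ∈S σ⋖τ , up σ∈S σ⋖τ

lemma63 : ∀ {n} (K : SimplicialComplex n) (d r : ℕ) →
    HasDimension K d → r < d →
    (ζ : SimplexSet K r) → IsCycle ζ → ¬ IsBoundary ζ →
    (S : SimplexSet K r) → IsMinimalSolution ζ S →
    Connected (inducedHasse S)
lemma63 K d r _ _ ζ cycle _ S minimal@(sol , _) = node , connected
  where
  node : ∃ (Graph.IsNode (inducedHasse S))
  node = let σ , σ∈S , _ = sol ζ cycle (∼-refl ζ) in (r , σ) , tt , member σ∈S

  connected : ∀ x y → Graph.IsNode (inducedHasse S) x → Graph.IsNode (inducedHasse S) y → Walk S x y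
  connected x y (_ , x∈) (_ , y∈)
    with u , u∈S , x↝u , _ ← walk-to-member S x∈
    with v , v∈S , _ , v↝y ← walk-to-member S y∈ =
    x↝u ◅◅ reachable⇒walk S (minimal⇒reachable S {ζ} minimal u∈S v∈S) ◅◅ v↝y
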